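{- The system $\mathtt{HDI}$ is sound with respect to topic-sensitive models: for every formula $\phi\in\mathcal{L}_{I^{d},G}$, if $\vdash_{\mathtt{HDI}}\phi$, then $\mathcal{M}\models\phi$ for every topic-sensitive model $\mathcal{M}$.
   Context: Language. Let $\mathtt{Prop}$ be a set of propositional variables. $\mathcal{L}_{I^{d},G}$ is given by $\phi:=p\mid\neg\phi\mid\phi\wedge\phi\mid I^{d}\phi\mid G\phi\mid\Box\phi$ with $p\in\mathtt{Prop}$; $\vee,\rightarrow,\leftrightarrow$ are defined classically. $Var(\phi)$ is the set of variables occurring in $\phi$. Models. A topic model is $\mathcal{T}=(T,\oplus,t,\mathfrak{K})$ with $T$ a non-empty set, $\oplus:T\times T\to T$ idempotent, commutative and associative, $\mathfrak{K}\in T$, and $t:\mathtt{Prop}\to T$. Extend $t$ to formulas by $t(\phi)=\oplus\{t(p):p\in Var(\phi)\}$, and put $a\sqsubseteq b$ iff $a\oplus b=b$. A topic-sensitive model is $\mathcal{M}=(W,R,v,\mathcal{T})$ with $W\neq\emptyset$, $R\subseteq W\times W$ arbitrary, $v:\mathtt{Prop}\to\mathcal{P}(W)$, and $\mathcal{T}$ a topic model. Truth: $\mathcal{M},w\models p$ iff $w\in v(p)$; $\neg,\wedge$ classical; $\mathcal{M},w\models\Box\phi$ iff $\mathcal{M},w'\models\phi$ for all $w'\in W$; $\mathcal{M},w\models G\phi$ iff $t(\phi)\sqsubseteq\mathfrak{K}$; $\mathcal{M},w\models I^{d}\phi$ iff $t(\phi)\sqsubseteq\mathfrak{K}$ and $\mathcal{M},w\models\phi$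 and for all $w'\neq w$, if $Rww'$ then $\mathcal{M},w'\models\neg\phi$. $\mathcal{M}\models\phi$ means $\mathcal{M},w\models\phi$ for all $w\in W$. System $\mathtt{HDI}$ (axiom schemas and rules): all classical propositional tautologies and Modus Ponens; all S5 axioms and rules for $\Box$; (G1) $G\phi\leftrightarrow G\neg\phi$; (G2) $G\phi\leftrightarrow GI^{d}\phi$; (G3) $G\phi\leftrightarrow G\Box\phi$; (G4) $(G\phi\wedge G\psi)\leftrightarrow G(\phi\wedge\psi)$; (G5) $G\phi\rightarrow\Box G\phi$; (HIR) from $\vdash\phi\rightarrow\psi$ infer $\vdash\phi\rightarrow(I^{d}\psi\rightarrow(G\phi\rightarrow I^{d}\phi))$; (A1) $I^{d}\phi\rightarrow\phi$; (A2) $(I^{d}\phi\wedge I^{d}\psi)\rightarrow I^{d}(\phi\vee\psi)$; (A3) $I^{d}\phi\rightarrow G\phi$. -}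

module Defs where

open import Algebra.Lattice.Structures using (IsSemilattice)
open import Data.Bool.Base as Bool using (Bool; true; not)
open import Data.List.NonEmpty.Base as List⁺ using (List⁺; [_]; _⁺++⁺_; foldr₁)
open import Data.Product.Base using (_×_)
open import Level using (Level; _⊔_; suc)
open import Relation.Binary.Core using (Rel)
open import Relation.Binary.PropositionalEquality.Core using (_≡_; _≢_)
open import Relation.Nullary.Negation.Core using (¬_)
open import Relation.Unary using (Pred)

private
  variable
    a ℓ : Level

infix  9 ~_ I_ G_ □_
infixr 8 _∧_
infixr 7 _∨_
infixr 6 _⇒_
infix  5 _⇔_

data Formula (Atom : Set a) : Set a where
  var : Atom → Formula Atom
  ~_  : Formula Atom → Formula Atom
  _∧_ : Formula Atom → Formula Atom → Formula Atom
  I_  : Formula Atom → Formula Atom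
  G_  : Formula Atom → Formula Atom
  □_  : Formula Atom → Formula Atom

private
  variable
    Atom : Set a

_∨_ : Formula Atom → Formula Atom → Formula Atom
φ ∨ ψ = ~ ((~ φ) ∧ (~ ψ))

_⇒_ : Formula Atom → Formula Atom → Formula Atom
φ ⇒ ψ = ~ (φ ∧ (~ ψ))

_⇔_ : Formula Atom → Formula Atom → Formula Atom
φ ⇔ ψ = (φ ⇒ ψ) ∧ (ψ ⇒ φ)

-- The set of variables of a formula, enumerated with repetitions. It is only
-- ever used under a join, which is insensitive to order and multiplicity.
Var : Formula Atom → List⁺ Atom
Var (var p) = [ p ]
Var (~ φ)   = Var φ
Var (φ ∧ ψ) = Var φ ⁺++⁺ Var ψ
Var (I φ)   = Var φ
Var (G φ)   = Var φ
Var (□ φ)   = Var φ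

-- T is non-empty because it contains 𝔎.
record TopicModel (Atom : Set a) (ℓ : Level) : Set (a ⊔ suc ℓ) where
  field
    T             : Set ℓ
    _⊕_           : T → T → T
    isSemilattice : IsSemilattice _≡_ _⊕_
    t             : Atom → T
    𝔎             : T

  _⊑_ : Rel T ℓ
  x ⊑ y = x ⊕ y ≡ y

  topic : Formula Atom → T
  topic φ = foldr₁ _⊕_ (List⁺.map t (Var φ))

record Model (Atom : Set a) (ℓ : Level) : Set (a ⊔ suc ℓ) where
  field
    W        : Set ℓ
    nonempty : W
    R        : Rel W ℓ
    v        : Atom → Pred W ℓ
    𝒯        : TopicModel Atom ℓ

  open TopicModel 𝒯 public

infix 4 _⊨[_]_ _⊨_

-- Truth is Set-valued, hence bivalent only under excluded middle. Without it
-- already □-K is unprovable: its instance at ~ ~ p and p is double-negation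
-- shift over W.

_⊨[_]_ : (M : Model Atom ℓ) → Model.W M → Formula Atom → Set ℓ
M ⊨[ w ] var p = Model.v M p w
M ⊨[ w ] ~ φ   = ¬ M ⊨[ w ] φ
M ⊨[ w ] φ ∧ ψ = M ⊨[ w ] φ × M ⊨[ w ] ψ
M ⊨[ w ] I φ   = topic φ ⊑ 𝔎 × M ⊨[ w ] φ × (∀ w′ → w′ ≢ w → R w w′ → ¬ M ⊨[ w′ ] φ)
  where open Model M
M ⊨[ w ] G φ   = topic φ ⊑ 𝔎
  where open Model M
M ⊨[ w ] □ φ   = ∀ w′ → M ⊨[ w′ ] φ

_⊨_ : Model Atom ℓ → Formula Atom → Set ℓ
M ⊨ φ = ∀ w → M ⊨[ w ] φ

-- Boolean evaluation in which variables and formulas with main connective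
-- I, G or □ are the propositional atoms; σ is only consulted on these.
eval : (Formula Atom → Bool) → Formula Atom → Bool
eval σ (~ φ)     = not (eval σ φ)
eval σ (φ ∧ ψ)   = eval σ φ Bool.∧ eval σ ψ
eval σ φ@(var _) = σ φ
eval σ φ@(I _)   = σ φ
eval σ φ@(G _)   = σ φ
eval σ φ@(□ _)   = σ φ

Tautology : Formula Atom → Set _
Tautology φ = ∀ σ → eval σ φ ≡ true

infix 3 HDI⊢_

data HDI⊢_ {a} {Atom : Set a} : Formula Atom → Set a where
  taut : ∀ {φ} → Tautology φ → HDI⊢ φ
  mp   : ∀ {φ ψ} → HDI⊢ φ ⇒ ψ → HDI⊢ φ → HDI⊢ ψ

  □-K   : ∀ φ ψ → HDI⊢ □ (φ ⇒ ψ) ⇒ □ φ ⇒ □ ψ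
  □-T   : ∀ φ → HDI⊢ □ φ ⇒ φ
  □-4   : ∀ φ → HDI⊢ □ φ ⇒ □ (□ φ)
  □-5   : ∀ φ → HDI⊢ ~ (□ φ) ⇒ □ (~ (□ φ))
  □-nec : ∀ {φ} → HDI⊢ φ → HDI⊢ □ φ

  G1 : ∀ φ → HDI⊢ G φ ⇔ G (~ φ)
  G2 : ∀ φ → HDI⊢ G φ ⇔ G (I φ)
  G3 : ∀ φ → HDI⊢ G φ ⇔ G (□ φ)
  G4 : ∀ φ ψ → HDI⊢ G φ ∧ G ψ ⇔ G (φ ∧ ψ)
  G5 : ∀ φ → HDI⊢ G φ ⇒ □ (G φ)

  HIR : ∀ {φ ψ} → HDI⊢ φ ⇒ ψ → HDI⊢ φ ⇒ I ψ ⇒ G φ ⇒ I φ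
  A1  : ∀ φ → HDI⊢ I φ ⇒ φ
  A2  : ∀ φ ψ → HDI⊢ I φ ∧ I ψ ⇒ I (φ ∨ ψ)
  A3  : ∀ φ → HDI⊢ I φ ⇒ G φ

{-# OPTIONS --safe #-}
module Submission where

open import Defs
open import Algebra.Definitions using (Associative)
open import Algebra.Lattice.Structures using (module IsSemilattice)
open import Axiom.ExcludedMiddle using (ExcludedMiddle)
open import Data.List.Base using ([]; _∷_)
open import Data.List.NonEmpty.Base as List⁺ using (List⁺; _∷_; _⁺++⁺_; foldr₁)
open import Data.Product.Base using (_×_; _,_; proj₁; proj₂)
open import Function.Base using (id)
open import Level using (Level)
open import Relation.Binary.PropositionalEquality
  using (_≡_; refl; sym; trans; cong; subst; module ≡-Reasoning)
open import Relation.Nullary.Decidable.Core using (does; proof; decidable-stable)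
open import Relation.Nullary.Negation.Core using (¬_)
open import Relation.Nullary.Reflects using (Reflects; invert; ¬-reflects; _×-reflects_)

private
  variable
    a b ℓ : Level
    A : Set a
    B : Set b
    P Q : Set ℓ

-- Induction on the derivation, proving truth at all worlds simultaneously, since necessitation and
-- `HIR` consult their premise at other worlds. The `G` axioms concern topics only: `~`, `I` and `□`
-- leave the variables unchanged, `G4` says that `⊕` is a least upper bound (`topic-∧-⊑⁺`,
-- `topic-∧-⊑⁻`), and `G5` holds because topics do not depend on the world. Excluded middle enters
-- twice: to turn truth at a world into a Boolean valuation (`eval-reflects`), and to detach
-- implications (`⇒-elim`).

foldr₁-map-⁺++⁺ : {_∙_ : B → B → B} → Associative _≡_ _∙_ → (f : A → B) (xs ys : List⁺ A) →
  foldr₁ _∙_ (List⁺.map f (xs ⁺++⁺ ys)) ≡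
  foldr₁ _∙_ (List⁺.map f xs) ∙ foldr₁ _∙_ (List⁺.map f ys)
foldr₁-map-⁺++⁺ {_∙_ = _∙_} assoc f (x₀ ∷ xs₀) ys = go x₀ xs₀
  where
  go : ∀ x xs → foldr₁ _∙_ (List⁺.map f ((x ∷ xs) ⁺++⁺ ys)) ≡
                foldr₁ _∙_ (List⁺.map f (x ∷ xs)) ∙ foldr₁ _∙_ (List⁺.map f ys)
  go x []        = refl
  go x (x′ ∷ xs) = trans (cong (f x ∙_) (go x′ xs)) (sym (assoc _ _ _))

module _ {Atom : Set a} (𝒯 : TopicModel Atom ℓ) where
  open TopicModel 𝒯
  open IsSemilattice _≡_ isSemilattice using (assoc; comm; idem)
  open ≡-Reasoning

  ⊕-lub : ∀ {x y z} → x ⊑ z → y ⊑ z → (x ⊕ y) ⊑ z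
  ⊕-lub {x} x⊑z y⊑z = trans (assoc _ _ _) (trans (cong (x ⊕_) y⊑z) x⊑z)

  -- Idempotence lets `x ⊕ y` absorb a further `x`, so `z`, rewritten as `(x ⊕ y) ⊕ z`, absorbs it
  -- too.
  ⊕-⊑ˡ : ∀ {x y z} → (x ⊕ y) ⊑ z → x ⊑ z
  ⊕-⊑ˡ {x} {y} {z} x⊕y⊑z = begin
    x ⊕ z             ≡⟨ cong (x ⊕_) x⊕y⊑z ⟨
    x ⊕ ((x ⊕ y) ⊕ z) ≡⟨ assoc _ _ _ ⟨
    (x ⊕ (x ⊕ y)) ⊕ z ≡⟨ cong (_⊕ z) (assoc _ _ _) ⟨
    ((x ⊕ x) ⊕ y) ⊕ z ≡⟨ cong (λ u → (u ⊕ y) ⊕ z) (idem x) ⟩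
    (x ⊕ y) ⊕ z       ≡⟨ x⊕y⊑z ⟩
    z                 ∎

  ⊕-⊑ʳ : ∀ {x y z} → (x ⊕ y) ⊑ z → y ⊑ z
  ⊕-⊑ʳ {x} {y} {z} x⊕y⊑z = ⊕-⊑ˡ (subst (_⊑ z) (comm x y) x⊕y⊑z)

  topic-∧ : ∀ φ ψ → topic (φ ∧ ψ) ≡ topic φ ⊕ topic ψ
  topic-∧ φ ψ = foldr₁-map-⁺++⁺ assoc t (Var φ) (Var ψ)

  topic-∧-⊑⁺ : ∀ φ ψ {x} → topic φ ⊑ x → topic ψ ⊑ x → topic (φ ∧ ψ) ⊑ x
  topic-∧-⊑⁺ φ ψ {x} φ⊑x ψ⊑x = subst (_⊑ x) (sym (topic-∧ φ ψ)) (⊕-lub φ⊑x ψ⊑x)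

  topic-∧-⊑⁻ : ∀ φ ψ {x} → topic (φ ∧ ψ) ⊑ x → topic φ ⊑ x × topic ψ ⊑ x
  topic-∧-⊑⁻ φ ψ {x} φψ⊑x = ⊕-⊑ˡ φ⊕ψ⊑x , ⊕-⊑ʳ φ⊕ψ⊑x
    where φ⊕ψ⊑x = subst (_⊑ x) (topic-∧ φ ψ) φψ⊑x

⇒-intro : (P → Q) → ¬ (P × ¬ Q)
⇒-intro f (p , ¬q) = ¬q (f p)

module _ (em : ExcludedMiddle ℓ) where

  -- The defined `⇒` yields only the double negation of its consequent, hence the classical step.
  ⇒-elim : {P Q : Set ℓ} → ¬ (P × ¬ Q) → P → Q
  ⇒-elim ¬[p×¬q] p = decidable-stable em λ ¬q → ¬[p×¬q] (p , ¬q)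

  module _ {Atom : Set a} (M : Model Atom ℓ) where
    open Model M

    -- The valuation is decided truth at `w`. As `eval` treats modal formulas as atoms, only `~` and
    -- `∧` need recursion.
    eval-reflects : ∀ w φ →
      Reflects (M ⊨[ w ] φ) (eval (λ ψ → does (em {M ⊨[ w ] ψ})) φ)
    eval-reflects w (var p) = proof em
    eval-reflects w (~ φ)   = ¬-reflects (eval-reflects w φ)
    eval-reflects w (φ ∧ ψ) = eval-reflects w φ ×-reflects eval-reflects w ψ
    eval-reflects w (I φ)   = proof em
    eval-reflects w (G φ)   = proof em
    eval-reflects w (□ φ)   = proof em

    tautology-valid : ∀ φ → Tautology φ → M ⊨ φ
    tautology-valid φ φ-taut w =
      invert (subst (Reflects _) (φ-taut _) (eval-reflects w φ))

    sound : ∀ {φ} → HDI⊢ φ → M ⊨ φ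
    sound (taut {φ} φ-taut) w = tautology-valid φ φ-taut w
    sound (mp ⊢φ⇒ψ ⊢φ)      w = ⇒-elim (sound ⊢φ⇒ψ w) (sound ⊢φ w)
    sound (□-K φ ψ)         w = ⇒-intro λ □φ⇒ψ → ⇒-intro λ □φ w′ → ⇒-elim (□φ⇒ψ w′) (□φ w′)
    sound (□-T φ)           w = ⇒-intro λ □φ → □φ w
    sound (□-4 φ)           w = ⇒-intro λ □φ _ → □φ
    -- Truth of `□ φ` does not mention the world, so its refutation serves everywhere.
    sound (□-5 φ)           w = ⇒-intro λ ¬□φ _ → ¬□φ
    sound (□-nec ⊢φ)        w = sound ⊢φ
    sound (G1 φ)            w = ⇒-intro id , ⇒-intro id
    sound (G2 φ)            w = ⇒-intro id , ⇒-intro id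
    sound (G3 φ)            w = ⇒-intro id , ⇒-intro id
    sound (G4 φ ψ)          w =
      ⇒-intro (λ (Gφ , Gψ) → topic-∧-⊑⁺ 𝒯 φ ψ Gφ Gψ) , ⇒-intro (topic-∧-⊑⁻ 𝒯 φ ψ)
    sound (G5 φ)            w = ⇒-intro λ Gφ _ → Gφ
    sound (HIR ⊢φ⇒ψ)        w =
      ⇒-intro λ wφ → ⇒-intro λ (_ , _ , ¬ψ) → ⇒-intro λ Gφ →
        -- The premise is valid, hence usable at `w′`: there `φ` would give `ψ`, which `I ψ`
        -- excludes.
        Gφ , wφ , λ w′ w′≢w Rww′ φ′ → ¬ψ w′ w′≢w Rww′ (⇒-elim (sound ⊢φ⇒ψ w′) φ′)
    sound (A1 φ)            w = ⇒-intro λ (_ , wφ , _) → wφ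
    sound (A2 φ ψ)          w =
      ⇒-intro λ ((Gφ , wφ , ¬φ) , (Gψ , _ , ¬ψ)) →
        -- `φ ∨ ψ` has by computation the same variable list as `φ ∧ ψ`.
        topic-∧-⊑⁺ 𝒯 φ ψ Gφ Gψ ,
        (λ (w¬φ , _) → w¬φ wφ) ,
        λ w′ w′≢w Rww′ φ∨ψ → φ∨ψ (¬φ w′ w′≢w Rww′ , ¬ψ w′ w′≢w Rww′)
    sound (A3 φ)            w = ⇒-intro proj₁

theorem5 : ∀ {a ℓ : Level} {Atom : Set a} → ExcludedMiddle ℓ →
    (φ : Formula Atom) → HDI⊢ φ → (M : Model Atom ℓ) → M ⊨ φ
theorem5 em φ ⊢φ M = sound em M ⊢φ
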